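{- Let $k\geq 2$ and let $n,p\geq 0$ be integers. The number of maximal hypercubes of dimension $p$ in the Munarini graph $M_{n,k}$ is $$h_p(M_{n,k})=(k-1)^{2p-n}\binom{p}{n-p}.$$
   Context: For integers $k\geq 1$, $n\geq 0$, a $k$-generalized Pell string of length $n$ is a word of length $n$ over the alphabet $\{0,1,\ldots,k\}$ in which every maximal run of the character $k$ has even length (equivalently, a concatenation of letters from $\{0,1,\ldots,k-1,kk\}$). Let $\mathcal{F}_{n,k}$ be the set of these strings (for $n=0$ it contains only the empty string). The Munarini graph $M_{n,k}$ is the simple graph with vertex set $\mathcal{F}_{n,k}$ in which two vertices are adjacent if one of them can be obtained from the other either by replacing one occurrence of $0$ with some $i\in\{1,\ldots,k-1\}$, or by replacing one substring $00$ (two consecutive positions) with $kk$ (both replacements may be read in either direction, and both strings must be in $\mathcal{F}_{n,k}$). A maximal hypercube of a graph $G$ is an induced subgraph of $G$ isomorphic to a hypercube $Q_p$ for some $p\geq 0$ ($Q_0=K_1$) that is not contained in a larger induced hypercube of $G$; $h_p(G)$ is the number of maximal hypercubes of dimension $p$ of $G$. Convention: $\binom{p}{n-p}=0$ if $n-p<0$ or $n-p>p$ (so the right-hand side is $0$ when $p<n/2$ or $p>n$). -}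

module Defs where

open import Data.Bool.Base using (Bool; T)
open import Data.Fin.Base using (Fin; zero; suc; fromℕ)
open import Data.Integer.Base using (ℤ; +_; -[1+_])
open import Data.List.Base using (List; _++_; replicate; head; last)
open import Data.Maybe.Base using (just)
open import Data.Nat.Base using (ℕ; suc; _≤_; s≤s)
open import Data.Nat.Combinatorics using (_C_)
open import Data.Nat.Divisibility using (_∣_)
open import Data.Product.Base using (Σ; ∃; _×_; _,_; proj₁)
open import Data.Refinement using (Refinement; value)
open import Data.Vec.Base using (Vec; []; _∷_; lookup; toList)
open import Data.Vec.Properties using (∷-injectiveˡ; ∷-injectiveʳ)
open import Function.Base using (_∘_; _on_)
open import Function.Bundles using (_↔_; _⇔_; Inverse)
open import Level using (0ℓ)
open import Relation.Binary.Bundles using (Setoid)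
open import Relation.Binary.Core using (Rel)
open import Relation.Binary.Definitions using (Symmetric; Irreflexive)
open import Relation.Binary.Construct.Closure.Symmetric using (SymClosure; fwd; bwd; symmetric)
open import Relation.Binary.PropositionalEquality using (_≡_; _≢_; refl; sym; trans; cong)
import Relation.Binary.PropositionalEquality.Properties as ≡

record Graph : Set₁ where
  infix 4 _∼_
  field
    V        : Set
    _∼_      : Rel V 0ℓ
    ∼-sym    : Symmetric _∼_
    ∼-irrefl : Irreflexive _≡_ _∼_

open Graph public using (V)

record _≅_ (G H : Graph) : Set where
  open Graph G using () renaming (_∼_ to _∼ᴳ_)
  open Graph H using () renaming (_∼_ to _∼ᴴ_)
  field
    bijection : V G ↔ V H
  open Inverse bijection public using (to; from)
  field
    adjacency : ∀ u v → (u ∼ᴳ v) ⇔ (to u ∼ᴴ to v)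

-- All graphs below are finite with decidable equality of vertices, so Boolean
-- predicates represent all vertex subsets.
VertexSet : Graph → Set
VertexSet G = V G → Bool

infix 4 _⊆_
_⊆_ : {A : Set} → (A → Bool) → (A → Bool) → Set
S ⊆ U = ∀ v → T (S v) → T (U v)

induced : (G : Graph) → VertexSet G → Graph
induced G S = record
  { V        = Σ (V G) (T ∘ S)
  ; _∼_      = _∼_ on proj₁
  ; ∼-sym    = ∼-sym
  ; ∼-irrefl = ∼-irrefl ∘ cong proj₁
  }
  where open Graph G using (_∼_; ∼-sym; ∼-irrefl)

DifferInExactlyOne : ∀ {p} → Rel (Vec Bool p) 0ℓ
DifferInExactlyOne x y =
  ∃ λ i → lookup x i ≢ lookup y i × (∀ j → j ≢ i → lookup x j ≡ lookup y j)

Q : ℕ → Graph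
Q p = record
  { V        = Vec Bool p
  ; _∼_      = DifferInExactlyOne
  ; ∼-sym    = λ (i , x≢y , x≡y) → i , x≢y ∘ sym , λ j j≢i → sym (x≡y j j≢i)
  ; ∼-irrefl = λ { refl (i , x≢x , _) → x≢x refl }
  }

-- An induced subgraph is identified with its vertex set.
IsHypercube : (G : Graph) → ℕ → VertexSet G → Set
IsHypercube G p S = induced G S ≅ Q p

IsMaximalHypercube : (G : Graph) → ℕ → VertexSet G → Set
IsMaximalHypercube G p S =
  IsHypercube G p S × (∀ U q → IsHypercube G q U → S ⊆ U → U ⊆ S)

-- Two maximal hypercubes are equal when they have the same vertices; the
-- choice of isomorphism with Q p is disregarded.
MaximalHypercubes : Graph → ℕ → Setoid 0ℓ 0ℓ
MaximalHypercubes G p = record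
  { Carrier       = Σ (VertexSet G) (IsMaximalHypercube G p)
  ; _≈_           = λ (S , _) (U , _) → ∀ v → S v ≡ U v
  ; isEquivalence = record
    { refl  = λ _ → refl
    ; sym   = λ S≡U v → sym (S≡U v)
    ; trans = λ S≡U U≡W v → trans (S≡U v) (U≡W v)
    }
  }

HasCardinality : Setoid 0ℓ 0ℓ → ℕ → Set
HasCardinality A N = Inverse A (≡.setoid (Fin N))

-- h G p ≐ N reads "h_p(G) = N".
infix 4 h_,_≐_
h_,_≐_ : Graph → ℕ → ℕ → Set
h G , p ≐ N = HasCardinality (MaximalHypercubes G p) N

Letter : ℕ → Set
Letter k = Fin (suc k)

Word : ℕ → ℕ → Set
Word k n = Vec (Letter k) n

-- Whenever w = u kᵐ v with u not ending in k and v not starting with k, i.e.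
-- kᵐ is a maximal run (or m = 0), m is even.
IsPell : ∀ {k n} → Word k n → Set
IsPell {k} w = ∀ (u v : List (Letter k)) m →
  toList w ≡ u ++ replicate m (fromℕ k) ++ v →
  last u ≢ just (fromℕ k) → head v ≢ just (fromℕ k) →
  2 ∣ m

-- Refinement makes the proof of IsPell irrelevant, so strings are equal as
-- soon as their underlying words are.
PellString : ℕ → ℕ → Set
PellString k n = Refinement (Word k n) IsPell

infix 4 _⇝_
data _⇝_ {k : ℕ} : ∀ {n} → Rel (Word k n) 0ℓ where
  0⇝i   : ∀ {n} {w : Word k n} (i : Letter k) → i ≢ zero → i ≢ fromℕ k →
          zero ∷ w ⇝ i ∷ w
  00⇝kk : ∀ {n} {w : Word k n} →
          zero ∷ zero ∷ w ⇝ fromℕ k ∷ fromℕ k ∷ w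
  there : ∀ {n} {w w′ : Word k n} (a : Letter k) → w ⇝ w′ →
          a ∷ w ⇝ a ∷ w′

⇝-irrefl : ∀ {k n} → 1 ≤ k → Irreflexive {A = Word k n} _≡_ _⇝_
⇝-irrefl 1≤k     eq (0⇝i i i≢0 _) = i≢0 (sym (∷-injectiveˡ eq))
⇝-irrefl (s≤s _) () 00⇝kk
⇝-irrefl 1≤k     eq (there a s)   = ⇝-irrefl 1≤k (∷-injectiveʳ eq) s

Munarini : (k n : ℕ) → 1 ≤ k → Graph
Munarini k n 1≤k = record
  { V        = PellString k n
  ; _∼_      = SymClosure _⇝_ on value
  ; ∼-sym    = symmetric _⇝_
  ; ∼-irrefl = λ { eq (fwd s) → ⇝-irrefl 1≤k (cong value eq) s
                 ; eq (bwd s) → ⇝-irrefl 1≤k (cong value (sym eq)) s }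
  }

-- Binomial coefficient with integer lower index, 0 if that index is negative
-- (_C_ is already 0 when it exceeds the upper index).
binomial : ℕ → ℤ → ℕ
binomial p (+ j)    = p C j
binomial p -[1+ _ ] = 0

{-# OPTIONS --safe #-}
module Submission where

-- Factor each Pell string into letters and blocks kk; an edge fills 0 with i
-- or 00 with kk, raising the number of nonzero blocks (the rank) by one.  In
-- an induced hypercube take a vertex of maximal rank.  All its edges go down,
-- and because two distinct strings have at most one common cover, so does
-- every edge leading away from it.  Hence the hypercube lies below a single
-- string, and, filling the remaining 0s, below a string without 0s.  The
-- strings below such a string with p blocks form an induced p-cube, so these
-- are exactly the maximal hypercubes.  A 0-free string of length n with p
-- blocks has n - p blocks kk and 2p - n letters from {1, …, k-1}.

open import Defs
open import Data.Bool.Base using (Bool; true; false; not; T)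
open import Data.Bool.Properties using (not-¬; T-irrelevant)
open import Data.Empty using (⊥; ⊥-elim; ⊥-elim-irr)
open import Data.Fin.Base using (Fin; zero; suc; fromℕ; inject₁)
import Data.Fin.Permutation as Permutation
import Data.Fin.Properties as Fin
open import Data.Fin.Relation.Unary.Top using (view; ‵fromℕ; ‵inject₁)
open import Data.Integer using (_⊖_)
open import Data.Integer.Properties using (⊖-≥; ⊖-<)
open import Data.Irrelevant using ([_])
open import Data.List.Base using ([]; _∷_; head; last)
import Data.List.Properties as List
open import Data.Maybe.Base using (just)
open import Data.Maybe.Properties using (just-injective)
open import Data.Nat using (ℕ; zero; suc; _≤_; _<_; _+_; _*_; _∸_; _^_; s≤s; s<s; z<s)
open import Data.Nat.Combinatorics using (_C_; nCk+nC[k+1]≡[n+1]C[k+1]; k>n⇒nCk≡0)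
open import Data.Nat.Divisibility using (_∣_; ∣-refl; ∣m∣n⇒∣m+n; ∣m+n∣m⇒∣n; _∣0; ∣1⇒≡1)
open import Data.Nat.Properties
open import Data.Product.Base using (Σ; ∃; ∃₂; _×_; _,_; proj₁; proj₂)
open import Data.Product.Function.NonDependent.Propositional using (_×-↔_)
open import Data.Refinement using (value; _,_)
open import Data.Refinement.Properties using (value-injective)
open import Data.Sum.Base using (_⊎_; inj₁; inj₂)
open import Data.Sum.Function.Propositional using (_⊎-↔_)
open import Data.Vec.Base using (Vec; []; _∷_; lookup; replicate; toList; updateAt)
import Data.Vec.Properties as Vec
open import Function.Base using (_∘_)
open import Function.Bundles using (_↔_; _⇔_; mk↔ₛ′; mk⇔; Inverse; Equivalence)
open import Function.Construct.Composition using (_⇔-∘_; inverse)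
open import Function.Properties.Inverse using (↔-refl; ↔-sym; ↔-trans)
open import Relation.Binary.Definitions using (tri<; tri≈; tri>)
open import Relation.Binary.Construct.Closure.Symmetric using (SymClosure; fwd; bwd)
open import Relation.Binary.PropositionalEquality
open import Relation.Nullary using (¬_; Dec; yes; no; contradiction)
open import Relation.Nullary.Decidable using (isYes; toWitness; fromWitness)

private variable
  m n p q : ℕ

-- Unique factorisation of Pell strings.

-- A tiling is the factorisation of a Pell string over {0, …, k-1, kk} for
-- k = suc m, with i : Fin m standing for the letter i + 1.
data Tiling (m : ℕ) : ℕ → Set where
  []   : Tiling m 0
  0∷_  : Tiling m n → Tiling m (suc n)
  _∷_  : Fin m → Tiling m n → Tiling m (suc n)
  kk∷_ : Tiling m n → Tiling m (suc (suc n))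

infixr 5 0∷_ kk∷_

word : Tiling m n → Word (suc m) n
word []      = []
word (0∷ t)  = zero ∷ word t
word (i ∷ t) = suc (inject₁ i) ∷ word t
word (kk∷ t) = fromℕ _ ∷ fromℕ _ ∷ word t

letter≢k : (i : Fin m) → suc (inject₁ i) ≢ fromℕ (suc m)
letter≢k i eq = Fin.fromℕ≢inject₁ (sym (Fin.suc-injective eq))

-- The first letter determines the first block, because `suc (inject₁ i)` is never the letter `k`.
word-injective : (s t : Tiling m n) → word s ≡ word t → s ≡ t
word-injective []      []       _  = refl
word-injective (0∷ s)  (0∷ t)   eq = cong 0∷_ (word-injective s t (Vec.∷-injectiveʳ eq))
word-injective (i ∷ s) (i′ ∷ t) eq = cong₂ _∷_
  (Fin.inject₁-injective (Fin.suc-injective (Vec.∷-injectiveˡ eq)))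
  (word-injective s t (Vec.∷-injectiveʳ eq))
word-injective (kk∷ s) (kk∷ t)  eq =
  cong kk∷_ (word-injective s t (Vec.∷-injectiveʳ (Vec.∷-injectiveʳ eq)))
word-injective (i ∷ s) (kk∷ t)  eq = contradiction (Vec.∷-injectiveˡ eq) (letter≢k i)
word-injective (kk∷ s) (i ∷ t)  eq = contradiction (sym (Vec.∷-injectiveˡ eq)) (letter≢k i)

module _ {a} {A : Set a} where

  last-tail≢ : ∀ {x y : A} u → last (x ∷ u) ≢ just y → last u ≢ just y
  last-tail≢ []      _  ()
  last-tail≢ (_ ∷ _) ≢y = ≢y

  last-cons≢ : ∀ {x y : A} u → x ≢ y → last u ≢ just y → last (x ∷ u) ≢ just y
  last-cons≢ []      x≢y _  = x≢y ∘ just-injective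
  last-cons≢ (_ ∷ _) _   ≢y = ≢y

-- A maximal run never splits a block `kk`: a prefix ending inside the block would end in `k`, and a
-- run stopping inside it would leave a remainder starting with `k`. So every run is a sequence of
-- whole blocks.
word-isPell : (t : Tiling m n) → IsPell (word t)
word-isPell []      []          v zero    eq _   _  = 2 ∣0
word-isPell []      []          v (suc r) ()
word-isPell []      (_ ∷ _)     v r       ()
word-isPell (0∷ t)  []          v zero    eq _   _  = 2 ∣0
word-isPell (0∷ t)  []          v (suc r) ()
word-isPell (0∷ t)  (x ∷ u)     v r       eq u≢k v≢k =
  word-isPell t u v r (List.∷-injectiveʳ eq) (last-tail≢ u u≢k) v≢k
word-isPell (i ∷ t) []          v zero    eq _   _  = 2 ∣0
word-isPell (i ∷ t) []          v (suc r) eq _   _  =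
  contradiction (List.∷-injectiveˡ eq) (letter≢k i)
word-isPell (i ∷ t) (x ∷ u)     v r       eq u≢k v≢k =
  word-isPell t u v r (List.∷-injectiveʳ eq) (last-tail≢ u u≢k) v≢k
word-isPell (kk∷ t) []          v zero    eq _   _  = 2 ∣0
word-isPell (kk∷ t) []          v (suc zero) eq _ v≢k =
  contradiction (cong head (sym (List.∷-injectiveʳ eq))) v≢k
word-isPell (kk∷ t) []          v (suc (suc r)) eq u≢k v≢k =
  ∣m∣n⇒∣m+n ∣-refl
    (word-isPell t [] v r (List.∷-injectiveʳ (List.∷-injectiveʳ eq)) u≢k v≢k)
word-isPell (kk∷ t) (x ∷ [])    v r       eq u≢k _  =
  contradiction (cong just (sym (List.∷-injectiveˡ eq))) u≢k
word-isPell (kk∷ t) (x ∷ y ∷ u) v r       eq u≢k v≢k =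
  word-isPell t u v r (List.∷-injectiveʳ (List.∷-injectiveʳ eq)) (last-tail≢ u u≢k) v≢k

module _ {k : ℕ} where

  IsPell-tail : ∀ {a : Letter k} {w : Word k n} → a ≢ fromℕ k → IsPell (a ∷ w) → IsPell w
  IsPell-tail {a = a} a≢k pell u v r eq u≢k =
    pell (a ∷ u) v r (cong (a ∷_) eq) (last-cons≢ u a≢k u≢k)

  -- A run at the start of `w` becomes longer by two, which preserves parity; any later run only
  -- gets a longer prefix.
  IsPell-drop-kk : ∀ {w : Word k n} → IsPell (fromℕ k ∷ fromℕ k ∷ w) → IsPell w
  IsPell-drop-kk pell []      v r eq u≢k v≢k =
    ∣m+n∣m⇒∣n (pell [] v (suc (suc r)) (cong (λ l → fromℕ k ∷ fromℕ k ∷ l) eq) u≢k v≢k) ∣-refl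
  IsPell-drop-kk pell (x ∷ u) v r eq u≢k v≢k =
    pell (fromℕ k ∷ fromℕ k ∷ x ∷ u) v r (cong (λ l → fromℕ k ∷ fromℕ k ∷ l) eq) u≢k v≢k

  2∤1 : ¬ 2 ∣ 1
  2∤1 2∣1 with () ← ∣1⇒≡1 2∣1

  ¬IsPell-k : ¬ IsPell {k} (fromℕ k ∷ [])
  ¬IsPell-k pell = 2∤1 (pell [] [] 1 refl (λ ()) (λ ()))

  ¬IsPell-kb : ∀ {b : Letter k} {w : Word k n} → b ≢ fromℕ k → ¬ IsPell (fromℕ k ∷ b ∷ w)
  ¬IsPell-kb {b = b} {w} b≢k pell =
    2∤1 (pell [] (b ∷ toList w) 1 refl (λ ()) (b≢k ∘ just-injective))

-- The proof of `IsPell` is erased in `PellString`, so the word alone steers the recursion; the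
-- proof only refutes a `k` that is not followed by a second `k`.
parse : (w : Word (suc m) n) → .(IsPell w) → ∃ λ (t : Tiling m n) → word t ≡ w
parse []         _ = [] , refl
parse (zero ∷ w) pell with t , refl ← parse w (IsPell-tail (λ ()) pell) = 0∷ t , refl
parse (suc a ∷ w) pell with view a
parse (suc _ ∷ w) pell | ‵inject₁ i
  with t , refl ← parse w (IsPell-tail (letter≢k i) pell) = i ∷ t , refl
parse (suc _ ∷ []) pell | ‵fromℕ = ⊥-elim-irr (¬IsPell-k pell)
parse (suc _ ∷ b ∷ w) pell | ‵fromℕ with b Fin.≟ fromℕ _
... | no  b≢k  = ⊥-elim-irr (¬IsPell-kb b≢k pell)
... | yes refl with t , refl ← parse w (IsPell-drop-kk pell) = kk∷ t , refl

tile : PellString (suc m) n → Tiling m n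
tile (w , [ pell ]) = proj₁ (parse w pell)

untile : Tiling m n → PellString (suc m) n
untile t = word t , [ word-isPell t ]

word-tile : (v : PellString (suc m) n) → word (tile v) ≡ value v
word-tile (w , [ pell ]) = proj₂ (parse w pell)

untile-tile : (v : PellString (suc m) n) → untile (tile v) ≡ v
untile-tile v = value-injective (word-tile v)

tile-untile : (t : Tiling m n) → tile (untile t) ≡ t
tile-untile t = word-injective _ _ (word-tile (untile t))

-- The covering relation on tilings and its rank.

infix 4 _⋖_ _∼_

data _⋖_ {m} : Tiling m n → Tiling m n → Set where
  0⋖i   : ∀ {t : Tiling m n} i → 0∷ t ⋖ i ∷ t
  00⋖kk : ∀ {t : Tiling m n} → 0∷ 0∷ t ⋖ kk∷ t
  0∷_   : ∀ {s t : Tiling m n} → s ⋖ t → 0∷ s ⋖ 0∷ t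
  _∷_   : ∀ {s t : Tiling m n} i → s ⋖ t → i ∷ s ⋖ i ∷ t
  kk∷_  : ∀ {s t : Tiling m n} → s ⋖ t → kk∷ s ⋖ kk∷ t

_∼_ : Tiling m n → Tiling m n → Set
_∼_ = SymClosure _⋖_

⋖⇒⇝ : {s t : Tiling m n} → s ⋖ t → word s ⇝ word t
⋖⇒⇝ (0⋖i i)   = 0⇝i _ (λ ()) (letter≢k i)
⋖⇒⇝ 00⋖kk     = 00⇝kk
⋖⇒⇝ (0∷ s⋖t)  = there _ (⋖⇒⇝ s⋖t)
⋖⇒⇝ (i ∷ s⋖t) = there _ (⋖⇒⇝ s⋖t)
⋖⇒⇝ (kk∷ s⋖t) = there _ (there _ (⋖⇒⇝ s⋖t))

-- The words are variables tied to `s` and `t` by equations, so that matching on the step need not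
-- unify its indices with applications of `word`.
⇝⇒⋖ : ∀ (s t : Tiling m n) {w w′} → word s ≡ w → word t ≡ w′ → w ⇝ w′ → s ⋖ t
⇝⇒⋖ (0∷ s) (0∷ t)  eq eq′ (0⇝i i i≢0 i≢k) =
  contradiction (sym (Vec.∷-injectiveˡ eq′)) i≢0
⇝⇒⋖ (0∷ s) (j ∷ t) eq eq′ (0⇝i i i≢0 i≢k)
  with refl ← word-injective s t (trans (Vec.∷-injectiveʳ eq) (sym (Vec.∷-injectiveʳ eq′))) = 0⋖i j
⇝⇒⋖ (0∷ s) (kk∷ t) eq eq′ (0⇝i i i≢0 i≢k) =
  contradiction (sym (Vec.∷-injectiveˡ eq′)) i≢k
⇝⇒⋖ (0∷ 0∷ s) (kk∷ t) eq eq′ 00⇝kk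
  with refl ← word-injective s t (trans (Vec.∷-injectiveʳ (Vec.∷-injectiveʳ eq))
                                   (sym (Vec.∷-injectiveʳ (Vec.∷-injectiveʳ eq′)))) = 00⋖kk
⇝⇒⋖ (0∷ 0∷ s) (i ∷ t) eq eq′ 00⇝kk =
  contradiction (Vec.∷-injectiveˡ eq′) (letter≢k i)
⇝⇒⋖ (0∷ s)  (0∷ t)  refl refl (there _ w⇝w′) = 0∷ ⇝⇒⋖ s t refl refl w⇝w′
⇝⇒⋖ (0∷ s)  (i ∷ t) refl ()   (there _ _)
⇝⇒⋖ (0∷ s)  (kk∷ t) refl ()   (there _ _)
⇝⇒⋖ (i ∷ s) (j ∷ t) refl eq′  (there _ w⇝w′)
  with refl ← Fin.inject₁-injective (Fin.suc-injective (Vec.∷-injectiveˡ eq′)) =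
  i ∷ ⇝⇒⋖ s t refl (Vec.∷-injectiveʳ eq′) w⇝w′
⇝⇒⋖ (i ∷ s) (kk∷ t) refl eq′  (there _ w⇝w′) =
  contradiction (sym (Vec.∷-injectiveˡ eq′)) (letter≢k i)
⇝⇒⋖ (kk∷ s) (i ∷ t) refl eq′  (there _ w⇝w′) =
  contradiction (Vec.∷-injectiveˡ eq′) (letter≢k i)
⇝⇒⋖ (kk∷ s) (kk∷ t) refl refl (there _ (there _ w⇝w′)) = kk∷ ⇝⇒⋖ s t refl refl w⇝w′

⇝⇔∼ : (u v : PellString (suc m) n) →
  SymClosure _⇝_ (value u) (value v) ⇔ (tile u ∼ tile v)
⇝⇔∼ u v = mk⇔
  (λ { (fwd u⇝v) → fwd (⇝⇒⋖ _ _ (word-tile u) (word-tile v) u⇝v)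
     ; (bwd v⇝u) → bwd (⇝⇒⋖ _ _ (word-tile v) (word-tile u) v⇝u) })
  (λ { (fwd u⋖v) → fwd (subst₂ _⇝_ (word-tile u) (word-tile v) (⋖⇒⇝ u⋖v))
     ; (bwd v⋖u) → bwd (subst₂ _⇝_ (word-tile v) (word-tile u) (⋖⇒⇝ v⋖u)) })

rank : Tiling m n → ℕ
rank []      = 0
rank (0∷ t)  = rank t
rank (_ ∷ t) = suc (rank t)
rank (kk∷ t) = suc (rank t)

rank-⋖ : {s t : Tiling m n} → s ⋖ t → rank t ≡ suc (rank s)
rank-⋖ (0⋖i i)   = refl
rank-⋖ 00⋖kk     = refl
rank-⋖ (0∷ s⋖t)  = rank-⋖ s⋖t
rank-⋖ (i ∷ s⋖t) = cong suc (rank-⋖ s⋖t)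
rank-⋖ (kk∷ s⋖t) = cong suc (rank-⋖ s⋖t)

-- `u` and `v` arise from `z` by emptying two different blocks, so each nonzero block of `z`
-- survives in `u` or in `v`. Thus `z` can be read off from `u` and `v`, and so can `w`.
common-cover-unique : {u v z w : Tiling m n} → u ≢ v →
  u ⋖ z → v ⋖ z → u ⋖ w → v ⋖ w → z ≡ w
common-cover-unique u≢v (0⋖i i) (0⋖i _) _ _ = contradiction refl u≢v
common-cover-unique u≢v (0⋖i i) (_ ∷ _) (0⋖i _) (_ ∷ _) = refl
common-cover-unique u≢v 00⋖kk 00⋖kk _ _ = contradiction refl u≢v
common-cover-unique u≢v 00⋖kk (kk∷ _) 00⋖kk (kk∷ _) = refl
common-cover-unique u≢v (0∷ _) (0∷ _) (0⋖i _) (0⋖i _) = contradiction refl u≢v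
common-cover-unique u≢v (0∷ _) (0∷ _) 00⋖kk 00⋖kk = contradiction refl u≢v
common-cover-unique u≢v (0∷ a) (0∷ b) (0∷ c) (0∷ d) =
  cong 0∷_ (common-cover-unique (u≢v ∘ cong 0∷_) a b c d)
common-cover-unique u≢v (_ ∷ _) (0⋖i _) (_ ∷ _) (0⋖i _) = refl
common-cover-unique u≢v (i ∷ a) (_ ∷ b) (_ ∷ c) (_ ∷ d) =
  cong (i ∷_) (common-cover-unique (u≢v ∘ cong (i ∷_)) a b c d)
common-cover-unique u≢v (kk∷ _) 00⋖kk (kk∷ _) 00⋖kk = refl
common-cover-unique u≢v (kk∷ a) (kk∷ b) (kk∷ c) (kk∷ d) =
  cong kk∷_ (common-cover-unique (u≢v ∘ cong kk∷_) a b c d)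

-- The top of an embedded hypercube.

argmax : (g : Vec Bool p → ℕ) → ∃ λ x → ∀ y → g y ≤ g x
argmax {zero}  g = [] , λ { [] → ≤-refl }
argmax {suc p} g
  with x₀ , max₀ ← argmax (λ x → g (false ∷ x)) | x₁ , max₁ ← argmax (λ x → g (true ∷ x))
  with ≤-total (g (false ∷ x₀)) (g (true ∷ x₁))
... | inj₁ ≤₁ = true ∷ x₁ , λ { (false ∷ y) → ≤-trans (max₀ y) ≤₁ ; (true ∷ y) → max₁ y }
... | inj₂ ≥₁ = false ∷ x₀ , λ { (false ∷ y) → max₀ y ; (true ∷ y) → ≤-trans (max₁ y) ≥₁ }

flip : Vec Bool p → Fin p → Vec Bool p
flip x i = updateAt x i not

lookup-flip≢ : (x : Vec Bool p) (i : Fin p) → lookup x i ≢ lookup (flip x i) i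
lookup-flip≢ x i eq = not-¬ refl (trans eq (Vec.lookup∘updateAt i x))

flip-differs : (x : Vec Bool p) (i : Fin p) → DifferInExactlyOne x (flip x i)
flip-differs x i = i , lookup-flip≢ x i , λ j j≢i → sym (Vec.lookup∘updateAt′ j i j≢i x)

-- Shortest paths from `x`: a step flips only a coordinate that still agrees with `x`, so it always
-- moves away from `x`.
data Path (x : Vec Bool p) : Vec Bool p → Set where
  start : Path x x
  step  : ∀ {y} → Path x y → ∀ i → lookup y i ≡ lookup x i → Path x (flip y i)

path-∷ : ∀ b {x y : Vec Bool p} → Path x y → Path (b ∷ x) (b ∷ y)
path-∷ b start            = start
path-∷ b (step path i eq) = step (path-∷ b path) (suc i) eq

path : (x y : Vec Bool p) → Path x y
path []          []          = start
path (false ∷ x) (false ∷ y) = path-∷ false (path x y)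
path (false ∷ x) (true ∷ y)  = step (path-∷ false (path x y)) zero refl
path (true ∷ x)  (false ∷ y) = step (path-∷ true (path x y)) zero refl
path (true ∷ x)  (true ∷ y)  = path-∷ true (path x y)

DownClosed : (Tiling m n → Set) → Set
DownClosed P = ∀ {s t} → s ⋖ t → P t → P s

module _ (f : Vec Bool p → Tiling m n)
         (f-injective : ∀ {x y} → f x ≡ f y → x ≡ y)
         (f-adjacent : ∀ {x y} → DifferInExactlyOne x y → f x ∼ f y) where

  private
    top : Vec Bool p
    top = proj₁ (argmax (rank ∘ f))

  -- Around a square whose vertex y has the larger rank, the vertex opposite
  -- to y cannot be a second common cover of its two neighbours.
  away-descends : ∀ {y} → Path top y → ∀ i → lookup y i ≡ lookup top i → f (flip y i) ⋖ f y
  away-descends start i _ with f-adjacent (flip-differs top i)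
  ... | bwd below = below
  ... | fwd above = contradiction (proj₂ (argmax (rank ∘ f)) (flip top i))
                      (<⇒≱ (≤-reflexive (sym (rank-⋖ above))))
  -- The square is spanned at the previous vertex `y` by the coordinates `j` and `i`. Both still
  -- agree with `top` at `y`, so by induction both edges at `y` descend.
  away-descends (step {y} path j y[j]≡) i y′[i]≡ = goal
    where
    i≢j : i ≢ j
    i≢j refl = lookup-flip≢ y i (trans y[j]≡ (sym y′[i]≡))

    y[i]≡ : lookup y i ≡ lookup top i
    y[i]≡ = trans (sym (Vec.lookup∘updateAt′ i j i≢j y)) y′[i]≡

    down-j : f (flip y j) ⋖ f y
    down-j = away-descends path j y[j]≡

    down-i : f (flip y i) ⋖ f y
    down-i = away-descends path i y[i]≡

    flip-comm : flip (flip y j) i ≡ flip (flip y i) j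
    flip-comm = Vec.updateAt-commutes i j i≢j y

    j≢i-flips : f (flip y j) ≢ f (flip y i)
    j≢i-flips eq = lookup-flip≢ y j (trans
      (sym (Vec.lookup∘updateAt′ j i (i≢j ∘ sym) y))
      (sym (cong (λ x → lookup x j) (f-injective eq))))

    opposite≢ : f y ≢ f (flip (flip y j) i)
    opposite≢ eq = lookup-flip≢ y j (trans
      (cong (λ x → lookup x j) (f-injective eq))
      (Vec.lookup∘updateAt′ j i (i≢j ∘ sym) (flip y j)))

    same-rank : rank (f (flip y i)) ≡ rank (f (flip y j))
    same-rank = suc-injective (trans (sym (rank-⋖ down-i)) (rank-⋖ down-j))

    goal : f (flip (flip y j) i) ⋖ f (flip y j)
    goal with f-adjacent (flip-differs (flip y j) i)
    ... | bwd below  = below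
    ... | fwd j⋖opp with f-adjacent (flip-differs (flip y i) j)
    ...   | fwd i⋖opp = contradiction
      (common-cover-unique j≢i-flips down-j down-i j⋖opp
        (subst (λ x → f (flip y i) ⋖ f x) (sym flip-comm) i⋖opp))
      opposite≢
    -- The opposite vertex would have a rank strictly between two equal ranks.
    ...   | bwd opp⋖i = contradiction
      (begin-strict
        rank (f (flip y j))               <⟨ ≤-reflexive (sym (rank-⋖ j⋖opp)) ⟩
        rank (f (flip (flip y j) i))      ≡⟨ cong (rank ∘ f) flip-comm ⟩
        rank (f (flip (flip y i) j))      <⟨ ≤-reflexive (sym (rank-⋖ opp⋖i)) ⟩
        rank (f (flip y i))               ≡⟨ same-rank ⟩
        rank (f (flip y j))               ∎)
      (<-irrefl refl)
      where open ≤-Reasoning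

  -- Lying below `t` is expressed through all down-closed predicates that hold at `t`; it will be
  -- applied to membership in a cube.
  hypercube-has-top : ∃ λ t → ∀ (P : Tiling m n → Set) → DownClosed P → P t → ∀ y → P (f y)
  hypercube-has-top = f top , λ P closed Pt y → along P closed Pt (path top y)
    where
    along : ∀ P → DownClosed P → P (f top) → ∀ {y} → Path top y → P (f y)
    along P closed Pt start            = Pt
    along P closed Pt (step path i eq) = closed (away-descends path i eq) (along P closed Pt path)

-- The cubes below 0-free tilings.

-- Tilings without 0; the first index is the number of blocks.
data Cover (m : ℕ) : ℕ → ℕ → Set where
  []   : Cover m 0 0
  _∷_  : Fin m → Cover m p n → Cover m (suc p) (suc n)
  kk∷_ : Cover m p n → Cover m (suc p) (suc (suc n))

-- Coordinates on the strings below a cover: a bit tells whether its block is kept or emptied. This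
-- becomes the isomorphism with `Q p`.
sub : Cover m p n → Vec Bool p → Tiling m n
sub []      []          = []
sub (i ∷ c) (false ∷ x) = 0∷ sub c x
sub (i ∷ c) (true ∷ x)  = i ∷ sub c x
sub (kk∷ c) (false ∷ x) = 0∷ 0∷ sub c x
sub (kk∷ c) (true ∷ x)  = kk∷ sub c x

infix 4 _∈_ _∈?_

_∈_ : Tiling m n → Cover m p n → Set
t ∈ c = ∃ λ x → sub c x ≡ t

-- Vertex sets are Boolean predicates, so a cube becomes a vertex set only through a decision
-- procedure.
_∈?_ : (t : Tiling m n) (c : Cover m p n) → Dec (t ∈ c)
[] ∈? [] = yes ([] , refl)
(0∷ t) ∈? (i ∷ c) with t ∈? c
... | yes (x , refl) = yes (false ∷ x , refl)
... | no  t∉c        = no λ { (false ∷ x , refl) → t∉c (x , refl) ; (true ∷ x , ()) }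
(j ∷ t) ∈? (i ∷ c) with i Fin.≟ j | t ∈? c
... | yes refl | yes (x , refl) = yes (true ∷ x , refl)
... | yes refl | no  t∉c        = no λ { (true ∷ x , refl) → t∉c (x , refl) ; (false ∷ x , ()) }
... | no  i≢j  | _              = no λ { (true ∷ x , refl) → i≢j refl ; (false ∷ x , ()) }
(kk∷ t) ∈? (i ∷ c) = no λ { (true ∷ x , ()) ; (false ∷ x , ()) }
(0∷ 0∷ t) ∈? (kk∷ c) with t ∈? c
... | yes (x , refl) = yes (false ∷ x , refl)
... | no  t∉c        = no λ { (false ∷ x , refl) → t∉c (x , refl) ; (true ∷ x , ()) }
(0∷ (i ∷ t)) ∈? (kk∷ c) = no λ { (true ∷ x , ()) ; (false ∷ x , ()) }
(0∷ kk∷ t) ∈? (kk∷ c) = no λ { (true ∷ x , ()) ; (false ∷ x , ()) }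
(i ∷ t) ∈? (kk∷ c) = no λ { (true ∷ x , ()) ; (false ∷ x , ()) }
(kk∷ t) ∈? (kk∷ c) with t ∈? c
... | yes (x , refl) = yes (true ∷ x , refl)
... | no  t∉c        = no λ { (true ∷ x , refl) → t∉c (x , refl) ; (false ∷ x , ()) }

0∷-injective : {s t : Tiling m n} → 0∷ s ≡ 0∷ t → s ≡ t
0∷-injective refl = refl

∷-injectiveˡ : ∀ {i j} {s t : Tiling m n} → i Tiling.∷ s ≡ j ∷ t → i ≡ j
∷-injectiveˡ refl = refl

∷-injectiveʳ : ∀ {i j} {s t : Tiling m n} → i Tiling.∷ s ≡ j ∷ t → s ≡ t
∷-injectiveʳ refl = refl

kk∷-injective : {s t : Tiling m n} → kk∷ s ≡ kk∷ t → s ≡ t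
kk∷-injective refl = refl

sub-injective : (c : Cover m p n) (x y : Vec Bool p) → sub c x ≡ sub c y → x ≡ y
sub-injective []      []          []          _  = refl
sub-injective (i ∷ c) (false ∷ x) (false ∷ y) eq =
  cong (false ∷_) (sub-injective c x y (0∷-injective eq))
sub-injective (i ∷ c) (true ∷ x)  (true ∷ y)  eq =
  cong (true ∷_) (sub-injective c x y (∷-injectiveʳ eq))
sub-injective (kk∷ c) (false ∷ x) (false ∷ y) eq =
  cong (false ∷_) (sub-injective c x y (0∷-injective (0∷-injective eq)))
sub-injective (kk∷ c) (true ∷ x)  (true ∷ y)  eq =
  cong (true ∷_) (sub-injective c x y (kk∷-injective eq))

-- The edges of `Q p` oriented from `false` to `true`, to match the orientation of `⋖`.
data Raise : Vec Bool p → Vec Bool p → Set where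
  here  : ∀ {x : Vec Bool p} → Raise (false ∷ x) (true ∷ x)
  there : ∀ b {x y : Vec Bool p} → Raise x y → Raise (b ∷ x) (b ∷ y)

raise⇒differ : {x y : Vec Bool p} → Raise x y → DifferInExactlyOne x y
raise⇒differ here = zero , (λ ()) , λ { zero 0≢0 → contradiction refl 0≢0 ; (suc _) _ → refl }
raise⇒differ (there b r) with i , x≢y , x≡y ← raise⇒differ r =
  suc i , x≢y , λ { zero _ → refl ; (suc j) j≢i → x≡y j (j≢i ∘ cong suc) }

lookup-injective : ∀ {a} {A : Set a} (x y : Vec A p) →
  (∀ i → lookup x i ≡ lookup y i) → x ≡ y
lookup-injective x y eq =
  trans (sym (Vec.tabulate∘lookup x)) (trans (Vec.tabulate-cong eq) (Vec.tabulate∘lookup y))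

differ⇒raise : (x y : Vec Bool p) → DifferInExactlyOne x y → SymClosure Raise x y
differ⇒raise (a ∷ x) (b ∷ y) (zero , a≢b , x≡y)
  with refl ← lookup-injective x y (λ i → x≡y (suc i) (λ ())) | a | b
... | false | false = contradiction refl a≢b
... | false | true  = fwd here
... | true  | false = bwd here
... | true  | true  = contradiction refl a≢b
differ⇒raise (a ∷ x) (b ∷ y) (suc i , x≢y , x≡y)
  with refl ← x≡y zero (λ ())
     | differ⇒raise x y (i , x≢y , λ j j≢i → x≡y (suc j) (j≢i ∘ Fin.suc-injective))
... | fwd r = fwd (there a r)
... | bwd r = bwd (there a r)

raise⇒⋖ : (c : Cover m p n) {x y : Vec Bool p} → Raise x y → sub c x ⋖ sub c y
raise⇒⋖ (i ∷ c) here            = 0⋖i i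
raise⇒⋖ (kk∷ c) here            = 00⋖kk
raise⇒⋖ (i ∷ c) (there false r) = 0∷ raise⇒⋖ c r
raise⇒⋖ (i ∷ c) (there true r)  = i ∷ raise⇒⋖ c r
raise⇒⋖ (kk∷ c) (there false r) = 0∷ 0∷ raise⇒⋖ c r
raise⇒⋖ (kk∷ c) (there true r)  = kk∷ raise⇒⋖ c r

-- The nonzero blocks of `sub c y` are blocks of `c`, so emptying one of them just lowers a bit of
-- `y`. Hence the cube is down-closed, and each covering inside it is an edge of `Q p`.
⋖-sub : (c : Cover m p n) (y : Vec Bool p) {s : Tiling m n} → s ⋖ sub c y →
  ∃ λ x → sub c x ≡ s × Raise x y
⋖-sub (i ∷ c) (false ∷ y) (0∷ s⋖) with x , refl , r ← ⋖-sub c y s⋖ =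
  false ∷ x , refl , there false r
⋖-sub (i ∷ c) (true ∷ y)  (0⋖i _) = false ∷ y , refl , here
⋖-sub (i ∷ c) (true ∷ y)  (_ ∷ s⋖) with x , refl , r ← ⋖-sub c y s⋖ =
  true ∷ x , refl , there true r
⋖-sub (kk∷ c) (false ∷ y) (0∷ 0∷ s⋖) with x , refl , r ← ⋖-sub c y s⋖ =
  false ∷ x , refl , there false r
⋖-sub (kk∷ c) (true ∷ y)  00⋖kk = false ∷ y , refl , here
⋖-sub (kk∷ c) (true ∷ y)  (kk∷ s⋖) with x , refl , r ← ⋖-sub c y s⋖ =
  true ∷ x , refl , there true r

⋖⇒raise : (c : Cover m p n) (x y : Vec Bool p) → sub c x ⋖ sub c y → Raise x y
⋖⇒raise c x y sub⋖ with x′ , eq , r ← ⋖-sub c y sub⋖ =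
  subst (λ z → Raise z y) (sub-injective c x′ x eq) r

∈-downClosed : (c : Cover m p n) → DownClosed (_∈ c)
∈-downClosed c s⋖t (y , refl) with x , eq , _ ← ⋖-sub c y s⋖t = x , eq

∼⇔differ : (c : Cover m p n) (x y : Vec Bool p) →
  (sub c x ∼ sub c y) ⇔ DifferInExactlyOne x y
∼⇔differ c x y = mk⇔ to from
  where
  to : sub c x ∼ sub c y → DifferInExactlyOne x y
  to (fwd x⋖y) = raise⇒differ (⋖⇒raise c x y x⋖y)
  to (bwd y⋖x) = Graph.∼-sym (Q _) {y} {x} (raise⇒differ (⋖⇒raise c y x y⋖x))

  from : DifferInExactlyOne x y → sub c x ∼ sub c y
  from differ with differ⇒raise x y differ
  ... | fwd r = fwd (raise⇒⋖ c r)
  ... | bwd r = bwd (raise⇒⋖ c r)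

-- Each remaining 0 is filled with the letter 1, encoded as `zero`; the index `suc m` guarantees
-- that this letter exists.
some-cover : (t : Tiling (suc m) n) → ∃₂ λ p (c : Cover (suc m) p n) → t ∈ c
some-cover [] = 0 , [] , [] , refl
some-cover (0∷ t) with p , c , x , refl ← some-cover t = suc p , zero ∷ c , false ∷ x , refl
some-cover (i ∷ t) with p , c , x , refl ← some-cover t = suc p , i ∷ c , true ∷ x , refl
some-cover (kk∷ t) with p , c , x , refl ← some-cover t = suc p , kk∷ c , true ∷ x , refl

full : Cover m p n → Tiling m n
full c = sub c (replicate _ true)

-- `full c` contains no 0, so the only vertex below `c′` that it can equal is `full c′`. The
-- conclusion compares pairs because `p` and `q` are not known to agree beforehand.
full-∈⇒≡ : (c : Cover m p n) (c′ : Cover m q n) → full c ∈ c′ →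
  _≡_ {A = ∃ λ r → Cover m r n} (p , c) (q , c′)
full-∈⇒≡ []      []       _ = refl
full-∈⇒≡ (i ∷ c) (j ∷ c′) (true ∷ x , eq) with refl ← ∷-injectiveˡ eq
  with refl ← full-∈⇒≡ c c′ (x , ∷-injectiveʳ eq) = refl
full-∈⇒≡ (i ∷ c) (j ∷ c′) (false ∷ x , ())
full-∈⇒≡ (i ∷ c) (kk∷ c′) (true ∷ x , ())
full-∈⇒≡ (i ∷ c) (kk∷ c′) (false ∷ x , ())
full-∈⇒≡ (kk∷ c) (j ∷ c′) (true ∷ x , ())
full-∈⇒≡ (kk∷ c) (j ∷ c′) (false ∷ x , ())
full-∈⇒≡ (kk∷ c) (kk∷ c′) (true ∷ x , eq)
  with refl ← full-∈⇒≡ c c′ (x , kk∷-injective eq) = refl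
full-∈⇒≡ (kk∷ c) (kk∷ c′) (false ∷ x , ())

-- Dimension from the number of vertices; Boolean subsets.

Vec-Bool↔Fin : ∀ p → Vec Bool p ↔ Fin (2 ^ p)
Vec-Bool↔Fin zero    = mk↔ₛ′ (λ _ → zero) (λ _ → []) (λ { zero → refl }) (λ { [] → refl })
Vec-Bool↔Fin (suc p) =
  ↔-trans uncons (↔-trans (↔-sym Fin.2↔Bool ×-↔ Vec-Bool↔Fin p) (↔-sym Fin.*↔×))
  where
  uncons : Vec Bool (suc p) ↔ (Bool × Vec Bool p)
  uncons = mk↔ₛ′ (λ { (b ∷ x) → b , x }) (λ { (b , x) → b ∷ x }) (λ _ → refl) (λ { (_ ∷ _) → refl })

2^-injective : ∀ p q → 2 ^ p ≡ 2 ^ q → p ≡ q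
2^-injective p q eq with <-cmp p q
... | tri< p<q _ _ = contradiction eq (<⇒≢ (^-monoʳ-< 2 (s<s z<s) p<q))
... | tri≈ _ p≡q _ = p≡q
... | tri> _ _ p>q = contradiction (sym eq) (<⇒≢ (^-monoʳ-< 2 (s<s z<s) p>q))

Vec-Bool-dimension : ∀ p q → Vec Bool p ↔ Vec Bool q → p ≡ q
Vec-Bool-dimension p q p↔q = 2^-injective p q
  (Permutation.↔⇒≡ (↔-trans (↔-sym (Vec-Bool↔Fin p)) (↔-trans p↔q (Vec-Bool↔Fin q))))

module _ {A : Set} where

  Subset-≡ : {S : A → Bool} {a b : Σ A (T ∘ S)} → proj₁ a ≡ proj₁ b → a ≡ b
  Subset-≡ {a = a , s} {.a , t} refl = cong (a ,_) (T-irrelevant s t)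

  ⊆-antisym : {S U : A → Bool} → S ⊆ U → U ⊆ S → ∀ v → S v ≡ U v
  ⊆-antisym {S} {U} S⊆U U⊆S v with S v | U v | S⊆U v | U⊆S v
  ... | true  | true  | _  | _  = refl
  ... | true  | false | su | _  = ⊥-elim (su _)
  ... | false | true  | _  | us = ⊥-elim (us _)
  ... | false | false | _  | _  = refl

  ⊆-reflexive : {S U : A → Bool} → (∀ v → S v ≡ U v) → S ⊆ U
  ⊆-reflexive eq v = subst T (eq v)

  ⊆-antisym-↔ : {S U : A → Bool} → S ⊆ U → U ⊆ S → Σ A (T ∘ S) ↔ Σ A (T ∘ U)
  ⊆-antisym-↔ S⊆U U⊆S = mk↔ₛ′
    (λ (v , s) → v , S⊆U v s) (λ (v , u) → v , U⊆S v u)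
    (λ _ → Subset-≡ refl) (λ _ → Subset-≡ refl)

-- Classification of the maximal hypercubes.

module _ {m n : ℕ} (1≤k : 1 ≤ suc (suc m)) where

  private
    M : Graph
    M = Munarini (suc (suc m)) n 1≤k

  cube : Cover (suc m) p n → VertexSet M
  cube c v = isYes (tile v ∈? c)

  cube-isHypercube : (c : Cover (suc m) p n) → IsHypercube M p (cube c)
  cube-isHypercube {p} c = record
    { bijection = mk↔ₛ′ to from
        (λ x → sub-injective c _ x (trans (sub-to (from x)) (tile-untile (sub c x))))
        (λ v → Subset-≡ (trans (cong untile (sub-to v)) (untile-tile (proj₁ v))))
    ; adjacency = λ u v →
        ∼⇔differ c (to u) (to v)
        ⇔-∘ subst₂ (λ s t → Graph._∼_ M (proj₁ u) (proj₁ v) ⇔ (s ∼ t))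
              (sym (sub-to u)) (sym (sub-to v)) (⇝⇔∼ (proj₁ u) (proj₁ v))
    }
    where
    to : Σ (V M) (T ∘ cube c) → Vec Bool p
    to (v , v∈c) = proj₁ (toWitness {a? = tile v ∈? c} v∈c)

    sub-to : ∀ v → sub c (to v) ≡ tile (proj₁ v)
    sub-to (v , v∈c) = proj₂ (toWitness {a? = tile v ∈? c} v∈c)

    from : Vec Bool p → Σ (V M) (T ∘ cube c)
    from x = untile (sub c x) , fromWitness (x , sym (tile-untile (sub c x)))

  -- The top of the hypercube lies in the cube of some cover, and that cube is down-closed.
  hypercube⊆cube : ∀ {S} → IsHypercube M q S → ∃₂ λ p (c : Cover (suc m) p n) → S ⊆ cube c
  hypercube⊆cube {q} {S} iso =
    let t , below-t   = hypercube-has-top f f-injective f-adjacent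
        p , c , t∈c   = some-cover t
    in p , c , λ v Sv → fromWitness
         (subst (λ u → tile (proj₁ u) ∈ c) (strictlyInverseʳ (v , Sv))
           (below-t (_∈ c) (∈-downClosed c) t∈c (to (v , Sv))))
    where
    open _≅_ iso
    open Inverse bijection using (strictlyInverseˡ; strictlyInverseʳ)

    f : Vec Bool q → Tiling (suc m) n
    f x = tile (proj₁ (from x))

    f-injective : ∀ {x y} → f x ≡ f y → x ≡ y
    f-injective {x} {y} eq = begin
      x            ≡⟨ strictlyInverseˡ x ⟨
      to (from x)  ≡⟨ cong to (Subset-≡ from-x≡from-y) ⟩
      to (from y)  ≡⟨ strictlyInverseˡ y ⟩
      y            ∎
      where
      open ≡-Reasoning
      from-x≡from-y : proj₁ (from x) ≡ proj₁ (from y)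
      from-x≡from-y = trans (sym (untile-tile _)) (trans (cong untile eq) (untile-tile _))

    f-adjacent : ∀ {x y} → DifferInExactlyOne x y → f x ∼ f y
    f-adjacent {x} {y} x∼y = Equivalence.to (⇝⇔∼ (proj₁ (from x)) (proj₁ (from y)))
      (Equivalence.from (adjacency (from x) (from y))
        (subst₂ DifferInExactlyOne (sym (strictlyInverseˡ x)) (sym (strictlyInverseˡ y)) x∼y))

  -- It suffices that the top vertex `full c` belongs to the larger cube. This yields both the
  -- maximality of cubes and the injectivity of `cube`.
  cube-⊆⇒≡ : (c : Cover (suc m) p n) (c′ : Cover (suc m) q n) →
    cube c ⊆ cube c′ → _≡_ {A = ∃ λ r → Cover (suc m) r n} (p , c) (q , c′)
  cube-⊆⇒≡ c c′ c⊆c′ = full-∈⇒≡ c c′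
    (subst (_∈ c′) (tile-untile (full c))
      (toWitness (c⊆c′ (untile (full c)) (fromWitness (_ , sym (tile-untile (full c)))))))

  cube-isMaximal : (c : Cover (suc m) p n) → IsMaximalHypercube M p (cube c)
  cube-isMaximal c = cube-isHypercube c , maximal
    where
    maximal : ∀ U q → IsHypercube M q U → cube c ⊆ U → U ⊆ cube c
    maximal U q U≅Q c⊆U
      -- The chain from `cube c` through `U` to `cube c′` collapses.
      with _ , c′ , U⊆c′ ← hypercube⊆cube U≅Q
      with refl ← cube-⊆⇒≡ c c′ (λ v → U⊆c′ v ∘ c⊆U v) = U⊆c′

  maximal⇒cube : ∀ {S} → IsMaximalHypercube M p S →
    ∃ λ (c : Cover (suc m) p n) → ∀ v → S v ≡ cube c v
  maximal⇒cube {p} (S≅Q , maximal)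
    with q , c , S⊆c ← hypercube⊆cube S≅Q
    -- Maximality gives the reverse inclusion; `p` and `q` then agree because equal vertex sets have
    -- equally many elements.
    with c⊆S ← maximal (cube c) q (cube-isHypercube c) S⊆c
    with refl ← Vec-Bool-dimension p q
           (↔-trans (↔-sym (_≅_.bijection S≅Q))
             (↔-trans (⊆-antisym-↔ S⊆c c⊆S) (_≅_.bijection (cube-isHypercube c))))
    = c , ⊆-antisym S⊆c c⊆S

  cube-injective : (c c′ : Cover (suc m) p n) → (∀ v → cube c v ≡ cube c′ v) → c ≡ c′
  cube-injective c c′ eq with refl ← cube-⊆⇒≡ c c′ (⊆-reflexive eq) = refl

  maximalHypercubes↔covers : Inverse (MaximalHypercubes M p) (setoid (Cover (suc m) p n))
  maximalHypercubes↔covers {p} = record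
    { to        = cover
    ; from      = λ c → cube c , cube-isMaximal c
    ; to-cong   = λ {S} {U} → cover-cong S U
    ; from-cong = λ c≡c′ v → cong (λ c → cube c v) c≡c′
    ; inverse   = (λ {c} {S} → cover-unique c S) , (λ {S} {c} → cube-cover S c)
    }
    where
    MaximalHypercube : Set
    MaximalHypercube = Σ (VertexSet M) (IsMaximalHypercube M p)

    cover : MaximalHypercube → Cover (suc m) p n
    cover (S , S-max) = proj₁ (maximal⇒cube {S = S} S-max)

    ≡cube-cover : (S : MaximalHypercube) → ∀ v → proj₁ S v ≡ cube (cover S) v
    ≡cube-cover (S , S-max) = proj₂ (maximal⇒cube {S = S} S-max)

    cover-unique : ∀ c S → (∀ v → proj₁ S v ≡ cube c v) → cover S ≡ c
    cover-unique c S S≡c =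
      cube-injective (cover S) c (λ v → trans (sym (≡cube-cover S v)) (S≡c v))

    cover-cong : ∀ S U → (∀ v → proj₁ S v ≡ proj₁ U v) → cover S ≡ cover U
    cover-cong S U S≡U = cover-unique (cover U) S (λ v → trans (S≡U v) (≡cube-cover U v))

    cube-cover : ∀ S c → c ≡ cover S → ∀ v → cube c v ≡ proj₁ S v
    cube-cover S _ refl v = sym (≡cube-cover S v)

-- Counting 0-free tilings.

count : ℕ → ℕ → ℕ → ℕ
count m zero    zero          = 1
count m zero    (suc n)       = 0
count m (suc p) zero          = 0
-- The summand 0 counts the covers of length 1 that begin with `kk`, mirroring the shape of the next
-- clause.
count m (suc p) (suc zero)    = m * count m p 0 + 0
count m (suc p) (suc (suc n)) = m * count m p (suc n) + count m p n

cover↔Fin : ∀ m p n → Cover m p n ↔ Fin (count m p n)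
cover↔Fin m zero zero = mk↔ₛ′ (λ _ → zero) (λ _ → []) (λ { zero → refl }) (λ { [] → refl })
cover↔Fin m zero (suc n) = mk↔ₛ′ (λ ()) (λ ()) (λ ()) (λ ())
cover↔Fin m (suc p) zero = mk↔ₛ′ (λ ()) (λ ()) (λ ()) (λ ())
cover↔Fin m (suc p) (suc zero) =
  ↔-trans first-block
    (↔-trans (↔-trans (↔-refl ×-↔ cover↔Fin m p 0) (↔-sym Fin.*↔×) ⊎-↔ ↔-sym Fin.0↔⊥)
      (↔-sym Fin.+↔⊎))
  where
  first-block : Cover m (suc p) 1 ↔ (Fin m × Cover m p 0 ⊎ ⊥)
  first-block = mk↔ₛ′
    (λ { (i ∷ c) → inj₁ (i , c) }) (λ { (inj₁ (i , c)) → i ∷ c })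
    (λ { (inj₁ _) → refl }) (λ { (_ ∷ _) → refl })
cover↔Fin m (suc p) (suc (suc n)) =
  ↔-trans first-block
    (↔-trans (↔-trans (↔-refl ×-↔ cover↔Fin m p (suc n)) (↔-sym Fin.*↔×) ⊎-↔ cover↔Fin m p n)
      (↔-sym Fin.+↔⊎))
  where
  first-block : Cover m (suc p) (suc (suc n)) ↔ (Fin m × Cover m p (suc n) ⊎ Cover m p n)
  first-block = mk↔ₛ′
    (λ { (i ∷ c) → inj₁ (i , c) ; (kk∷ c) → inj₂ c })
    (λ { (inj₁ (i , c)) → i ∷ c ; (inj₂ c) → kk∷ c })
    (λ { (inj₁ _) → refl ; (inj₂ _) → refl }) (λ { (_ ∷ _) → refl ; (kk∷ _) → refl })

-- Every block has length at least one.
count-< : ∀ m {p n} → n < p → count m p n ≡ 0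
count-< m {suc p} {zero}        _         = refl
count-< m {suc p} {suc zero}    (s<s 0<p) rewrite count-< m 0<p | *-zeroʳ m = refl
count-< m {suc p} {suc (suc n)} (s<s n<p)
  rewrite count-< m n<p | count-< m (<-trans (n<1+n n) n<p) | *-zeroʳ m = refl

-- After an initial `kk` the remaining length would be smaller than the remaining number of blocks.
count-step-≤ : ∀ m {p n} → n ≤ p → count m (suc p) (suc n) ≡ m * count m p n
count-step-≤ m {p} {zero}  _   = +-identityʳ _
count-step-≤ m {p} {suc n} n<p rewrite count-< m n<p = +-identityʳ _

-- For `j < p` the two exponents differ by exactly one; otherwise the subtraction may truncate, but
-- the binomial coefficient vanishes.
^-step-C : ∀ m p j → m * (m ^ (p ∸ suc j) * (p C suc j)) ≡ m ^ (p ∸ j) * (p C suc j)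
^-step-C m p j with <-≤-connex j p
... | inj₁ j<p = begin
  m * (m ^ (p ∸ suc j) * (p C suc j))  ≡⟨ *-assoc m _ _ ⟨
  m ^ suc (p ∸ suc j) * (p C suc j)    ≡⟨ cong (λ e → m ^ e * (p C suc j)) (+-∸-assoc 1 j<p) ⟨
  m ^ (p ∸ j) * (p C suc j)            ∎
  where open ≡-Reasoning
... | inj₂ p≤j rewrite k>n⇒nCk≡0 (s≤s p≤j) | *-zeroʳ (m ^ (p ∸ suc j)) | *-zeroʳ (m ^ (p ∸ j)) = *-zeroʳ m

-- Here `j` is the number of blocks `kk`, and `p ∸ j` the number of single letters. Splitting by the
-- first block turns the induction into Pascal's rule.
count-+ : ∀ m p j → count m p (p + j) ≡ m ^ (p ∸ j) * (p C j)
count-+ m zero    zero    = refl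
count-+ m zero    (suc j) = sym (trans (*-identityˡ _) (k>n⇒nCk≡0 {0} {suc j} z<s))
count-+ m (suc p) zero    = begin
  count m (suc p) (suc p + 0)  ≡⟨ count-step-≤ m (≤-reflexive (+-identityʳ p)) ⟩
  m * count m p (p + 0)        ≡⟨ cong (m *_) (count-+ m p 0) ⟩
  m * (m ^ p * 1)              ≡⟨ *-assoc m _ _ ⟨
  m ^ suc p * 1                ∎
  where open ≡-Reasoning
count-+ m (suc p) (suc j) = begin
  count m (suc p) (suc p + suc j)
    ≡⟨ cong (count m (suc p) ∘ suc) (+-suc p j) ⟩
  m * count m p (suc (p + j)) + count m p (p + j)
    ≡⟨ cong (λ l → m * count m p l + count m p (p + j)) (+-suc p j) ⟨
  m * count m p (p + suc j) + count m p (p + j)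
    ≡⟨ cong₂ (λ a b → m * a + b) (count-+ m p (suc j)) (count-+ m p j) ⟩
  m * (m ^ (p ∸ suc j) * (p C suc j)) + m ^ (p ∸ j) * (p C j)
    ≡⟨ cong (_+ m ^ (p ∸ j) * (p C j)) (^-step-C m p j) ⟩
  m ^ (p ∸ j) * (p C suc j) + m ^ (p ∸ j) * (p C j)
    ≡⟨ *-distribˡ-+ (m ^ (p ∸ j)) _ _ ⟨
  m ^ (p ∸ j) * (p C suc j + p C j)
    ≡⟨ cong (m ^ (p ∸ j) *_) (trans (+-comm (p C suc j) _) (nCk+nC[k+1]≡[n+1]C[k+1] p j)) ⟩
  m ^ (p ∸ j) * (suc p C suc j) ∎
  where open ≡-Reasoning

-- The truncated exponent is harmless: if `n` exceeds `2 * p`, the lower index exceeds `p` and the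
-- binomial coefficient is 0.
count-formula : ∀ m p n → count m p n ≡ m ^ (2 * p ∸ n) * binomial p (n ⊖ p)
count-formula m p n with <-≤-connex n p
... | inj₁ n<p rewrite ⊖-< n<p with p ∸ n | m<n⇒0<n∸m n<p
-- Positivity of `p ∸ n` makes the lower index negative, so `binomial` takes its default value 0.
...   | suc _ | _ = trans (count-< m n<p) (sym (*-zeroʳ (m ^ (2 * p ∸ n))))
count-formula m p n | inj₂ p≤n with j , refl ← m≤n⇒∃[o]m+o≡n p≤n
  rewrite ⊖-≥ p≤n | m+n∸m≡n p j | [m+n]∸[m+o]≡n∸o p (p + 0) j | +-identityʳ p = count-+ m p j

corollary4p12 : (k n p : ℕ) (2≤k : 2 ≤ k) →
    h Munarini k n (<⇒≤ 2≤k) , p ≐ ((k ∸ 1) ^ (2 * p ∸ n) * binomial p (n ⊖ p))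
corollary4p12 (suc zero) n p (s≤s ())
corollary4p12 (suc (suc m)) n p 2≤k = subst (h Munarini (suc (suc m)) n (<⇒≤ 2≤k) , p ≐_)
  (count-formula (suc m) p n)
  (inverse (maximalHypercubes↔covers (<⇒≤ 2≤k)) (cover↔Fin (suc m) p n))
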